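{- Let $G$ be a planar $3$-regular graph of diameter $3$ with $8$ or $10$ vertices. Then $h(G) = 7$.
   Context: All graphs are finite, simple and undirected. A harmonious coloring of a graph $G$ with $k$ colors is a proper vertex coloring $c : V(G) \to \{1,\dots,k\}$ such that for every two distinct colors $i,j$ there is at most one pair of adjacent vertices colored with $i$ and $j$. The harmonious chromatic number $h(G)$ is the minimum positive integer $k$ for which $G$ has a harmonious coloring with $k$ colors. The diameter of a connected graph is the largest distance between two of its vertices; a graph of diameter $3$ is in particular connected. -}

module Defs where

open import Data.Bool using (Bool; T)
open import Data.Bool.Properties using (T?)
open import Data.Fin using (Fin; _<?_)
open import Data.List using (length; filter; allFin; cartesianProduct)
open import Data.Nat using (ℕ; zero; suc; _+_; _*_; _≤_; _≟_)
open import Data.Nat.GeneralisedArithmetic using (iterate)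
open import Data.Product using (_×_; _,_; ∃; ∃-syntax; Σ-syntax)
open import Function.Bundles using (_⇔_)
open import Function.Definitions using (Surjective)
open import Relation.Binary.Core using (Rel)
open import Relation.Binary.PropositionalEquality using (_≡_; _≢_)
open import Relation.Nullary using (¬_)
open import Relation.Nullary.Decidable using (_×-dec_)
open import Level using (0ℓ)

-- Finite simple graphs with vertex set Fin n.
record Graph (n : ℕ) : Set where
  field
    adj : Fin n → Fin n → Bool

  Adj : Rel (Fin n) 0ℓ
  Adj u v = T (adj u v)

  field
    adj-sym    : ∀ {u v} → Adj u v → Adj v u
    adj-irrefl : ∀ {v} → ¬ Adj v v

module _ {n : ℕ} (G : Graph n) where
  open Graph G

  degree : Fin n → ℕ
  degree v = length (filter (λ w → T? (adj v w)) (allFin n))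

  Regular : ℕ → Set
  Regular r = ∀ v → degree v ≡ r

  -- Each edge is counted once, as the pair of its ends in increasing order.
  edgeCount : ℕ
  edgeCount = length (filter (λ (u , v) → (u <? v) ×-dec T? (adj u v))
                             (cartesianProduct (allFin n) (allFin n)))

  isolatedCount : ℕ
  isolatedCount = length (filter (λ v → degree v ≟ 0) (allFin n))

  data Walk : Fin n → Fin n → ℕ → Set where
    stop : ∀ {u} → Walk u u zero
    step : ∀ {u v w k} → Adj u v → Walk v w k → Walk u w (suc k)

  Reachable : Rel (Fin n) 0ℓ
  Reachable u v = ∃[ k ] Walk u v k

  IsDistance : Fin n → Fin n → ℕ → Set
  IsDistance u v d = Walk u v d × (∀ k → Walk u v k → d ≤ k)

  -- The first component makes every two vertices lie at finite distance, so a
  -- graph with a diameter is connected.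
  IsDiameter : ℕ → Set
  IsDiameter d = (∀ u v → ∃[ k ] IsDistance u v k × k ≤ d)
               × (∃[ u ] ∃[ v ] IsDistance u v d)

  record IsHarmonious {k : ℕ} (c : Fin n → Fin k) : Set where
    field
      proper : ∀ {u v} → Adj u v → c u ≢ c v
      -- Naming the end coloured i first identifies the edges with ends
      -- coloured i and j with ordered pairs.
      atMostOneEdge : ∀ {i j} → i ≢ j → ∀ {u v x y} →
        Adj u v → c u ≡ i → c v ≡ j →
        Adj x y → c x ≡ i → c y ≡ j →
        u ≡ x × v ≡ y

  HarmoniouslyColorable : ℕ → Set
  HarmoniouslyColorable k = ∃[ c ] IsHarmonious {k} c

  IsHarmoniousChromaticNumber : ℕ → Set
  IsHarmoniousChromaticNumber k =
    1 ≤ k × HarmoniouslyColorable k ×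
    (∀ j → 1 ≤ j → HarmoniouslyColorable j → k ≤ j)

  record Dart : Set where
    constructor dart
    field
      src tgt : Fin n
      edge    : Adj src tgt

  open Dart

  reverse : Dart → Dart
  reverse (dart u v e) = dart v u (adj-sym e)

  -- A cyclic order on the darts leaving each vertex.  As these are finite in
  -- number, transitivity makes rot a cyclic permutation of them.
  record RotationSystem : Set where
    field
      rot        : Dart → Dart
      rot-src    : ∀ d → src (rot d) ≡ src d
      rot-cyclic : ∀ d e → src d ≡ src e → ∃[ k ] iterate rot d k ≡ e

    -- After traversing d, leave its target along the next dart in the rotation.
    faceNext : Dart → Dart
    faceNext d = rot (reverse d)

    SameFace : Rel Dart 0ℓ
    SameFace d e = ∃[ k ] iterate faceNext d k ≡ e

-- R is an equivalence relation with exactly k classes.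
HasClasses : ∀ {A : Set} → Rel A 0ℓ → ℕ → Set
HasClasses {A} R k =
  Σ[ class ∈ (A → Fin k) ]
    Surjective _≡_ _≡_ class × (∀ x y → R x y ⇔ class x ≡ class y)

-- Planarity as the existence of a combinatorial map on spheres: a rotation
-- system describes a cellular embedding of each component with edges in a
-- closed orientable surface, the facial walks being the orbits of faceNext.
-- Such a component has V - E + F ≤ 2, with equality exactly when its surface is
-- the sphere; an isolated vertex lies on no dart, and isolatedCount supplies
-- the single face of its sphere.  Summed over the components, the equation
-- V + F = E + 2C therefore holds exactly when all surfaces are spheres.
Planar : ∀ {n} → Graph n → Set
Planar {n} G =
  Σ[ R ∈ RotationSystem G ] ∃[ f ] ∃[ c ]
    HasClasses (RotationSystem.SameFace R) f ×
    HasClasses (Reachable G) c ×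
    n + (f + isolatedCount G) ≡ edgeCount G + 2 * c

{-# OPTIONS --safe #-}
module Submission where

-- Two vertices of the same colour see 6 distinct further colours, so fewer than
-- 7 colours would make a harmonious colouring injective.  Conversely 7 colours
-- suffice on 8 vertices by merging two vertices at distance 3.  On 10 vertices
-- one needs three disjoint pairs at distance 3 with at most one edge between
-- any two of them.  Running through the connected cubic graphs on 10 vertices
-- in breadth-first order shows that such pairs exist unless the diameter
-- exceeds 3 or the graph is one of seven.  These seven are not planar: by
-- Euler's formula a spherical rotation system would have 7 faces, but each of
-- the 2 ^ 10 rotation systems has fewer.

open import Defs
open import Data.Bool using (Bool; true; false; T; if_then_else_; _∧_; _∨_; not; _xor_)
open import Data.Bool.ListAction using (any; all)
open import Data.Bool.Properties using (T?; T-≡; T-∧; T-∨; T-irrelevant)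
open import Data.Empty using (⊥; ⊥-elim)
open import Data.Fin as Fin using (Fin; zero; suc; toℕ; _≟_; punchOut)
open import Data.Fin.Patterns
open import Data.Fin.Properties
  using (all?; any?; pigeonhole; punchOut-injective; suc-injective; <-cmp; <⇒≢)
open import Data.List
  using (List; []; _∷_; _++_; _∷ʳ_; map; length; filter; filterᵇ; foldl; concatMap; allFin
        ; cartesianProduct; zip)
import Data.List.Membership.DecPropositional as DecMembership
open import Data.List.Membership.Propositional using (_∈_; _∉_; find)
open import Data.List.Membership.Propositional.Properties
  using (∈-∃++; ∈-++⁻; ∈-++⁺ˡ; ∈-++⁺ʳ; ∈-map⁺; ∈-map⁻; ∈-filter⁺; ∈-filter⁻; ∈-allFin
        ; ∈-cartesianProduct⁺; ∈-concatMap⁺)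
open import Data.List.Properties
  using (length-++; length-map; length-tabulate; filter-++; filter-none)
open import Data.List.Relation.Binary.Subset.Propositional using (_⊆_)
open import Data.List.Relation.Unary.All as All using (All; []; _∷_)
open import Data.List.Relation.Unary.All.Properties using (¬Any⇒All¬; ¬All⇒Any¬)
open import Data.List.Relation.Unary.AllPairs as AllPairs using ([]; _∷_)
open import Data.List.Relation.Unary.Any as Any using (Any; here; there)
open import Data.List.Relation.Unary.Any.Properties using (any⁻)
open import Data.List.Relation.Unary.Unique.Propositional using (Unique)
open import Data.List.Relation.Unary.Unique.Propositional.Properties
  using (allFin⁺; filter⁺; map⁺; ++⁺; cartesianProduct⁺; Unique[x∷xs]⇒x∉xs)
open import Data.Nat as ℕ
  using (ℕ; zero; suc; _+_; _*_; _≤_; _<_; _<?_; z≤n; s≤s; _≡ᵇ_; _<ᵇ_; _≤ᵇ_)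
open import Data.Nat.GeneralisedArithmetic using (iterate)
open import Data.Nat.Induction using (Acc; acc; <-wellFounded)
open import Data.Nat.Properties
  using (≤-trans; ≤-reflexive; ≤-antisym; +-suc; +-identityʳ; +-cancelˡ-≤; +-monoˡ-≤; +-monoʳ-≤
        ; *-monoʳ-≤; 1+n≰n; n≮n; ≮⇒≥; <ᵇ⇒<; ≡ᵇ⇒≡; ≡⇒≡ᵇ; module ≤-Reasoning)
open import Data.Nat.Tactic.RingSolver using (solve-∀)
open import Data.Product using (_×_; _,_; proj₁; proj₂; ∃-syntax; swap; uncurry)
open import Data.Sum using (_⊎_; inj₁; inj₂; [_,_]′) renaming (map to ⊎-map)
open import Data.Vec as Vec using (Vec; []; _∷_; lookup; updateAt; replicate; tabulate; toList)
open import Data.Vec.Membership.Propositional.Properties using (∈-lookup; ∈-toList⁺)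
open import Data.Vec.Properties
  using (lookup∘updateAt; lookup∘updateAt′; lookup-replicate; lookup∘tabulate; lookup-map)
open import Function using (_∘_; id)
open import Function.Bundles using (Equivalence)
open import Function.Definitions using (Injective)
open import Level using (0ℓ)
open import Relation.Binary.Definitions using (tri<; tri≈; tri>)
open import Relation.Binary.PropositionalEquality
  using (_≡_; _≢_; refl; sym; trans; cong; cong₂; subst; subst₂)
open import Relation.Nullary using (¬_; Dec; does; yes; no; contradiction)
open import Relation.Nullary.Decidable
  using (⌊_⌋; toWitness; from-yes; ¬?; _×-dec_; _→-dec_)
open import Relation.Unary using (Pred; Decidable)

-- On ten vertices the colour classes are three pairs and four single vertices. Distance at least 3
-- makes a pair independent and leaves it without a common neighbour, so two edges with the same two
-- colours could only run between two of the pairs, which is what the bound of one edge excludes.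
-- Some cubic graphs of small diameter admit no such triple: the Petersen graph has diameter 2 and
-- no pair at all. This is where planarity must enter. The large case analyses are Boolean functions
-- evaluated by the type checker, and each is used in one direction only: `true` yields the claim.
-- Hence the enumeration may meet a graph many times over, and the colourings and isomorphisms
-- offered at its leaves may come from unverified searches. Completeness of the enumeration is
-- proved by letting `G` itself choose the way down the search tree.

-- Counting with duplicate-free lists

unique-⊆-length : ∀ {A : Set} {xs ys : List A} →
  Unique xs → xs ⊆ ys → length xs ≤ length ys
unique-⊆-length {xs = []} _ _ = z≤n
unique-⊆-length {xs = x ∷ xs} (x# ∷ uxs) xs⊆ys with ∈-∃++ (xs⊆ys (here refl))
... | as , bs , refl =
  ≤-trans (s≤s (unique-⊆-length uxs xs⊆as++bs))
          (≤-reflexive (trans (cong suc (length-++ as))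
                       (trans (sym (+-suc (length as) (length bs))) (sym (length-++ as)))))
  where
  xs⊆as++bs : xs ⊆ as ++ bs
  xs⊆as++bs y∈xs with ∈-++⁻ as (xs⊆ys (there y∈xs))
  ... | inj₁ y∈as         = ∈-++⁺ˡ y∈as
  ... | inj₂ (here refl)  = contradiction y∈xs (Unique[x∷xs]⇒x∉xs (x# ∷ uxs))
  ... | inj₂ (there y∈bs) = ∈-++⁺ʳ as y∈bs

unique-fin-length : ∀ {n} {xs : List (Fin n)} → Unique xs → length xs ≤ n
unique-fin-length {n} uxs =
  ≤-trans (unique-⊆-length uxs (λ {i} _ → ∈-allFin i)) (≤-reflexive (length-tabulate id))

-- Stated with membership, since the colourings below are injective on a
-- neighbourhood only.
unique-map : ∀ {A B : Set} {f : A → B} {xs} →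
  (∀ {x y} → x ∈ xs → y ∈ xs → f x ≡ f y → x ≡ y) → Unique xs → Unique (map f xs)
unique-map {xs = []}             inj _           = []
unique-map {f = f} {xs = x ∷ xs} inj (x# ∷ uxs) =
  ¬Any⇒All¬ _ fx∉ ∷ unique-map (λ p q → inj (there p) (there q)) uxs
  where
  fx∉ : f x ∉ map f xs
  fx∉ fx∈ with ∈-map⁻ f fx∈
  ... | y , y∈xs , fx≡fy =
    Unique[x∷xs]⇒x∉xs (x# ∷ uxs) (subst (_∈ xs) (sym (inj (here refl) (there y∈xs) fx≡fy)) y∈xs)

-- A missed value together with the image would be n + 1 distinct elements of `Fin n`.
injective⇒surjective : ∀ {n} {f : Fin n → Fin n} →
  Injective _≡_ _≡_ f → ∀ y → ∃[ x ] f x ≡ y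
injective⇒surjective {n} {f} inj y with y ∈? map f (allFin n)
  where open DecMembership _≟_ using (_∈?_)
... | yes y∈ with ∈-map⁻ f y∈
...   | x , _ , y≡fx = x , sym y≡fx
injective⇒surjective {n} {f} inj y | no y∉ =
  contradiction (unique-fin-length (¬Any⇒All¬ _ y∉ ∷ unique-map (λ _ _ → inj) (allFin⁺ n)))
    (λ le → 1+n≰n (≤-trans (≤-reflexive (cong suc (sym image-length))) le))
  where
  image-length : length (map f (allFin n)) ≡ n
  image-length = trans (length-map f (allFin n)) (length-tabulate id)

-- Harmonious colourings and the lower bound

module _ {n : ℕ} (G : Graph n) where
  open Graph G

  neighbours : Fin n → List (Fin n)
  neighbours v = filter (λ w → T? (adj v w)) (allFin n)

  ∈-neighbours⁺ : ∀ {v w} → Adj v w → w ∈ neighbours v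
  ∈-neighbours⁺ {v} {w} = ∈-filter⁺ (λ w → T? (adj v w)) (∈-allFin w)

  ∈-neighbours⁻ : ∀ {v w} → w ∈ neighbours v → Adj v w
  ∈-neighbours⁻ {v} = proj₂ ∘ ∈-filter⁻ (λ w → T? (adj v w)) {xs = allFin n}

  unique-neighbours : ∀ v → Unique (neighbours v)
  unique-neighbours v = filter⁺ (λ w → T? (adj v w)) (allFin⁺ n)

  -- One condition that covers both clauses of harmony: a dart is determined by the ordered pair of
  -- its end colours.
  DartInjective : ∀ {k} → (Fin n → Fin k) → Set
  DartInjective c = ∀ {u v x y} → Adj u v → Adj x y → c u ≡ c x → c v ≡ c y → u ≡ x × v ≡ y

  -- Properness is the comparison of a dart with its reverse.
  dartInjective⇒harmonious : ∀ {k} {c : Fin n → Fin k} → DartInjective c → IsHarmonious G c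
  dartInjective⇒harmonious inj = record
    { proper        = λ uv cu≡cv →
        adj-irrefl (subst (Adj _) (sym (proj₁ (inj uv (adj-sym uv) cu≡cv (sym cu≡cv)))) uv)
    ; atMostOneEdge = λ _ uv cu cv xy cx cy → inj uv xy (trans cu (sym cx)) (trans cv (sym cy))
    }

  harmonious-bound : ∀ {r k} → Regular G r → HarmoniouslyColorable G k → k < n → 2 * r < k
  harmonious-bound {r} {k} regular (c , harmonious) k<n with pigeonhole k<n c
  ... | u , v , u<v , cu≡cv = ≤-trans (≤-reflexive colours-length) (unique-fin-length unique-colours)
    where
    open IsHarmonious harmonious

    u≢v : u ≢ v
    u≢v = <⇒≢ u<v

    colours : List (Fin k)
    colours = c u ∷ map c (neighbours u) ++ map c (neighbours v)

    length-colours : ∀ v → length (map c (neighbours v)) ≡ r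
    length-colours v = trans (length-map c (neighbours v)) (regular v)

    colours-length : suc (2 * r) ≡ length colours
    colours-length = cong suc (sym (trans (length-++ (map c (neighbours u)))
      (cong₂ _+_ (length-colours u) (trans (length-colours v) (sym (+-identityʳ r))))))

    unique-at : ∀ v → Unique (map c (neighbours v))
    unique-at v = unique-map
      (λ x∈ y∈ cx≡cy → proj₂ (atMostOneEdge (proper (∈-neighbours⁻ x∈))
          (∈-neighbours⁻ x∈) refl refl (∈-neighbours⁻ y∈) refl (sym cx≡cy)))
      (unique-neighbours v)

    own-colour : ∀ v → c v ∉ map c (neighbours v)
    own-colour v cv∈ with ∈-map⁻ c cv∈
    ... | x , x∈ , cv≡cx = proper (∈-neighbours⁻ x∈) cv≡cx

    disjoint : ∀ {z} → ¬ (z ∈ map c (neighbours u) × z ∈ map c (neighbours v))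
    -- A common colour would give `u` and `v`, which share theirs, an edge each in the same colour
    -- pair.
    disjoint (z∈u , z∈v) with ∈-map⁻ c z∈u | ∈-map⁻ c z∈v
    ... | x , x∈ , refl | y , y∈ , cx≡cy =
      u≢v (proj₁ (atMostOneEdge (proper (∈-neighbours⁻ x∈)) (∈-neighbours⁻ x∈) refl refl
                                (∈-neighbours⁻ y∈) (sym cu≡cv) (sym cx≡cy)))

    unique-colours : Unique colours
    unique-colours = ¬Any⇒All¬ _ cu∉ ∷ ++⁺ (unique-at u) (unique-at v) disjoint
      where
      cu∉ : c u ∉ map c (neighbours u) ++ map c (neighbours v)
      cu∉ cu∈ with ∈-++⁻ (map c (neighbours u)) cu∈
      ... | inj₁ cu∈u = own-colour u cu∈u
      ... | inj₂ cu∈v = own-colour v (subst (_∈ map c (neighbours v)) cu≡cv cu∈v)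

-- Merging two vertices at distance 3

module _ {n : ℕ} (G : Graph (suc n)) where
  open Graph G

  merge-far-pair : ∀ {a b} → IsDistance G a b 3 → HarmoniouslyColorable G n
  merge-far-pair {a} {b} (_ , minimal) = c , dartInjective⇒harmonious G inj
    where
    ¬walk : ∀ {k} → Walk G a b k → ¬ k < 3
    ¬walk w k<3 = n≮n 3 (≤-trans (s≤s (minimal _ w)) k<3)

    a≢b : a ≢ b
    a≢b refl = ¬walk stop (s≤s z≤n)

    a≁b : ¬ Adj a b
    a≁b e = ¬walk (step e stop) (s≤s (s≤s z≤n))

    no-common : ∀ {x} → Adj a x → ¬ Adj x b
    no-common e f = ¬walk (step e (step f stop)) (s≤s (s≤s (s≤s z≤n)))

    -- `b` takes the colour of `a`, every other vertex has its own, and `punchOut` closes the gap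
    -- left at `b`.
    c : Fin (suc n) → Fin n
    c v with b ≟ v
    ... | yes _  = punchOut (a≢b ∘ sym)
    ... | no b≢v = punchOut b≢v

    data Same : Fin (suc n) → Fin (suc n) → Set where
      equal : ∀ {v} → Same v v
      ab    : Same a b
      ba    : Same b a

    same : ∀ {u v} → c u ≡ c v → Same u v
    same {u} {v} cu≡cv with b ≟ u | b ≟ v
    ... | yes refl | yes refl = equal
    ... | yes refl | no b≢v with punchOut-injective (a≢b ∘ sym) b≢v cu≡cv
    ...   | refl = ba
    same {u} {v} cu≡cv | no b≢u | yes refl with punchOut-injective b≢u (a≢b ∘ sym) cu≡cv
    ...   | refl = ab
    same {u} {v} cu≡cv | no b≢u | no b≢v with punchOut-injective b≢u b≢v cu≡cv
    ...   | refl = equal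

    inj : DartInjective G c
    inj uv xy cu≡cx cv≡cy with same cu≡cx | same cv≡cy
    -- If just one end is exchanged, its fixed partner is a common neighbour of `a` and `b`; if both
    -- are, there is a loop or an edge between `a` and `b`.
    ... | equal | equal = refl , refl
    ... | equal | ab    = ⊥-elim (no-common (adj-sym uv) xy)
    ... | equal | ba    = ⊥-elim (no-common (adj-sym xy) uv)
    ... | ab    | equal = ⊥-elim (no-common uv (adj-sym xy))
    ... | ba    | equal = ⊥-elim (no-common xy (adj-sym uv))
    ... | ab    | ab    = ⊥-elim (adj-irrefl uv)
    ... | ab    | ba    = ⊥-elim (a≁b uv)
    ... | ba    | ab    = ⊥-elim (a≁b xy)
    ... | ba    | ba    = ⊥-elim (adj-irrefl uv)

-- Graphs given by adjacency lists

Rows : ℕ → Set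
Rows n = Vec (List (Fin n)) n

-- An isomorphism from the listed graph to `G`; surjectivity of `vertex` follows from finiteness.
-- The lists are a function, so that search results and fixed tables share this notion.
record Presentation {n : ℕ} (G : Graph n) (rows : Fin n → List (Fin n)) : Set where
  open Graph G
  field
    vertex           : Fin n → Fin n
    vertex-injective : Injective _≡_ _≡_ vertex
    sound            : ∀ {i j} → j ∈ rows i → Adj (vertex i) (vertex j)
    complete         : ∀ {i j} → Adj (vertex i) (vertex j) → j ∈ rows i

module _ {n : ℕ} where
  addEdge : Fin n → Fin n → Rows n → Rows n
  addEdge i j R = updateAt (updateAt R i (j ∷_)) j (i ∷_)

  private
    cons-at⁻ : ∀ {i j k p} (R : Rows n) → k ∈ lookup (updateAt R i (j ∷_)) p →
      (p ≡ i × k ≡ j) ⊎ k ∈ lookup R p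
    cons-at⁻ {i} {j} {k} {p} R k∈ with p ≟ i
    ... | yes refl with subst (k ∈_) (lookup∘updateAt p R) k∈
    ...   | here refl = inj₁ (refl , refl)
    ...   | there k∈′ = inj₂ k∈′
    cons-at⁻ {i} {j} {k} {p} R k∈ | no p≢i = inj₂ (subst (k ∈_) (lookup∘updateAt′ p i p≢i R) k∈)

    cons-at⁺ : ∀ {i j p} (R : Rows n) → lookup R p ⊆ lookup (updateAt R i (j ∷_)) p
    cons-at⁺ {i} {j} {p} R {k} k∈ with p ≟ i
    ... | yes refl = subst (k ∈_) (sym (lookup∘updateAt p R)) (there k∈)
    ... | no p≢i   = subst (k ∈_) (sym (lookup∘updateAt′ p i p≢i R)) k∈

    cons-at-new : ∀ {i j} (R : Rows n) → j ∈ lookup (updateAt R i (j ∷_)) i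
    cons-at-new {i} {j} R = subst (j ∈_) (sym (lookup∘updateAt i R)) (here refl)

    cons-at-unique : ∀ {i j p} (R : Rows n) → j ∉ lookup R i → Unique (lookup R p) →
      Unique (lookup (updateAt R i (j ∷_)) p)
    cons-at-unique {i} {j} {p} R j∉ u with p ≟ i
    ... | yes refl = subst Unique (sym (lookup∘updateAt p R)) (¬Any⇒All¬ _ j∉ ∷ u)
    ... | no p≢i   = subst Unique (sym (lookup∘updateAt′ p i p≢i R)) u

  module _ (i j : Fin n) (R : Rows n) where
    addEdge⁻ : ∀ {k} p → k ∈ lookup (addEdge i j R) p →
      ((p ≡ i × k ≡ j) ⊎ (p ≡ j × k ≡ i)) ⊎ k ∈ lookup R p
    addEdge⁻ p k∈ with cons-at⁻ (updateAt R i (j ∷_)) k∈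
    ... | inj₁ new = inj₁ (inj₂ new)
    ... | inj₂ k∈′ = ⊎-map inj₁ id (cons-at⁻ R k∈′)

    addEdge⁺ : ∀ p → lookup R p ⊆ lookup (addEdge i j R) p
    addEdge⁺ p = cons-at⁺ (updateAt R i (j ∷_)) ∘ cons-at⁺ R

    addEdge-new : j ∈ lookup (addEdge i j R) i
    addEdge-new = cons-at⁺ (updateAt R i (j ∷_)) (cons-at-new R)

    addEdge-new′ : i ∈ lookup (addEdge i j R) j
    addEdge-new′ = cons-at-new (updateAt R i (j ∷_))

    addEdge-unique : ∀ {p} → i ≢ j → j ∉ lookup R i → i ∉ lookup R j → Unique (lookup R p) →
      Unique (lookup (addEdge i j R) p)
    addEdge-unique i≢j j∉ i∉ = cons-at-unique (updateAt R i (j ∷_))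
      (λ i∈ → [ (λ (j≡i , _) → i≢j (sym j≡i)) , i∉ ]′ (cons-at⁻ R i∈)) ∘ cons-at-unique R j∉

-- Enumeration of connected regular graphs

-- The labels in used stand for known vertices, those in todo still have
-- unexplored rows, and a neighbour outside the known vertices gets the first
-- fresh label, so that fresh labels are never permuted.
module Search {n : ℕ} (r : ℕ) (leaf : Rows n → Bool) where
  open DecMembership (_≟_ {n}) using (_∈?_)

  explore : ℕ → (fresh used todo : List (Fin n)) → Rows n → Bool
  row     : ℕ → (fresh used todo : List (Fin n)) → Fin n → List (Fin n) → Rows n → Bool
  branch  : ℕ → (fresh used todo : List (Fin n)) → Fin n → List (Fin n) → Rows n → Bool

  explore zero    F       U todo       R = false
  explore (suc k) F       U (i ∷ todo) R = row k F U todo i U R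
  explore (suc k) []      U []         R = leaf R
  explore (suc k) (_ ∷ _) U []         R = true

  row k F U todo i js R =
    if length (lookup R i) ≡ᵇ r then explore k F U todo R else branch k F U todo i js R

  branch k F U todo i (j ∷ js) R =
    if does (i ≟ j) ∨ does (j ∈? lookup R i) then row k F U todo i js R
    else row k F U todo i js R
         ∧ ((length (lookup R j) ≡ᵇ r) ∨ row k F U todo i js (addEdge i j R))
  branch k []      U todo i [] R = true
  branch k (f ∷ F) U todo i [] R = row k F (f ∷ U) (todo ∷ʳ f) i [] (addEdge i f R)

search : ∀ {n} (r : ℕ) (leaf : Rows (suc n) → Bool) → Bool
search {n} r leaf =
  Search.explore r leaf (2 + n) (map suc (allFin n)) (zero ∷ []) (zero ∷ []) (replicate _ [])

module SearchSound {n r : ℕ} (G : Graph n) (regular : Regular G r)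
  (connected : ∀ u v → Reachable G u v)
  (leaf : Rows n → Bool) {Goal : Set}
  (leaf-sound : ∀ R → leaf R ≡ true → Presentation G (lookup R) → Goal)
  where

  open Graph G
  open Search r leaf
  open DecMembership (_≟_ {n}) using (_∈?_)

  -- The invariant tying a search state to `G`. `vertex` is total, but only its values on used
  -- labels count; those at fresh labels are placeholders until `relabel` overwrites them.
  record Partial (F U : List (Fin n)) (R : Rows n) (vertex : Fin n → Fin n) : Set where
    field
      fresh∉used   : All (_∉ U) F
      fresh-unique : Unique F
      cover        : ∀ i → i ∈ F ⊎ i ∈ U
      injective    : ∀ {i j} → i ∈ U → j ∈ U → vertex i ≡ vertex j → i ≡ j
      edge         : ∀ {i j} → j ∈ lookup R i → j ∈ U × Adj (vertex i) (vertex j)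
      symmetric    : ∀ {i j} → j ∈ lookup R i → i ∈ lookup R j
      row-unique   : ∀ i → Unique (lookup R i)
      inhabited    : ∃[ i ] i ∈ U

  Closed : Rows n → (Fin n → Fin n) → Fin n → Set
  Closed R vertex i = ∀ {w} → Adj (vertex i) w → ∃[ j ] j ∈ lookup R i × vertex j ≡ w

  module _ {F U R vertex} (P : Partial F U R vertex) where
    open Partial P

    images : Fin n → List (Fin n)
    images i = map vertex (lookup R i)

    images-unique : ∀ i → Unique (images i)
    images-unique i =
      unique-map (λ p q → injective (proj₁ (edge p)) (proj₁ (edge q))) (row-unique i)

    images⊆neighbours : ∀ i → images i ⊆ neighbours G (vertex i)
    images⊆neighbours i w∈ with ∈-map⁻ vertex w∈
    ... | _ , j∈ , refl = ∈-neighbours⁺ G (proj₂ (edge j∈))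

    -- The r listed neighbours are distinct, so an unlisted one would raise the degree above r.
    full⇒closed : ∀ {i} → length (lookup R i) ≡ r → Closed R vertex i
    full⇒closed {i} full {w} iw with w ∈? images i
    ... | yes w∈ with ∈-map⁻ vertex w∈
    ...   | j , j∈ , w≡ = j , j∈ , sym w≡
    full⇒closed {i} full {w} iw | no w∉ = contradiction
      (≤-trans (≤-reflexive (cong suc (sym (trans (length-map vertex (lookup R i)) full))))
        (≤-trans (unique-⊆-length (¬Any⇒All¬ _ w∉ ∷ images-unique i) sub)
                 (≤-reflexive (regular (vertex i)))))
      1+n≰n
      where
      sub : w ∷ images i ⊆ neighbours G (vertex i)
      sub (here refl) = ∈-neighbours⁺ G iw
      sub (there x∈)  = images⊆neighbours i x∈

    new-neighbour : ∀ {i} → length (lookup R i) ≢ r → ∃[ w ] Adj (vertex i) w × w ∉ images i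
    new-neighbour {i} ¬full with All.all? (_∈? images i) (neighbours G (vertex i))
    ... | yes all∈ = contradiction (≤-antisym
      (≤-trans (≤-reflexive (sym (length-map vertex (lookup R i))))
        (≤-trans (unique-⊆-length (images-unique i) (images⊆neighbours i))
                 (≤-reflexive (regular (vertex i)))))
      (≤-trans (≤-reflexive (sym (regular (vertex i))))
        (≤-trans (unique-⊆-length (unique-neighbours G (vertex i)) (All.lookup all∈))
                 (≤-reflexive (length-map vertex (lookup R i)))))) ¬full
    ... | no ¬all with find (¬All⇒Any¬ (_∈? images i) _ ¬all)
    ...   | w , w∈ , w∉ = w , ∈-neighbours⁻ G w∈ , w∉

    addEdge-partial : ∀ {i j} → i ∈ U → j ∈ U → i ≢ j → j ∉ lookup R i →
      Adj (vertex i) (vertex j) → Partial F U (addEdge i j R) vertex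
    addEdge-partial {i} {j} i∈ j∈ i≢j j∉ ij = record
      { Partial P
      ; edge       = edge′
      ; symmetric  = symmetric′
      ; row-unique = λ p → addEdge-unique i j R i≢j j∉ (j∉ ∘ symmetric) (row-unique p)
      }
      where
      edge′ : ∀ {p k} → k ∈ lookup (addEdge i j R) p → k ∈ U × Adj (vertex p) (vertex k)
      edge′ k∈ with addEdge⁻ i j R _ k∈
      ... | inj₁ (inj₁ (refl , refl)) = j∈ , ij
      ... | inj₁ (inj₂ (refl , refl)) = i∈ , adj-sym ij
      ... | inj₂ k∈′                  = edge k∈′
      symmetric′ : ∀ {p k} → k ∈ lookup (addEdge i j R) p → p ∈ lookup (addEdge i j R) k
      symmetric′ k∈ with addEdge⁻ i j R _ k∈
      ... | inj₁ (inj₁ (refl , refl)) = addEdge-new′ i j R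
      ... | inj₁ (inj₂ (refl , refl)) = addEdge-new i j R
      ... | inj₂ k∈′                  = addEdge⁺ i j R _ (symmetric k∈′)

    labelled : (∀ {i} → i ∈ U → Closed R vertex i) → ∀ w → ∃[ i ] i ∈ U × vertex i ≡ w
    labelled closed w = along (proj₂ inhabited) (proj₂ (connected (vertex (proj₁ inhabited)) w))
      where
      along : ∀ {i k} → i ∈ U → Walk G (vertex i) w k → ∃[ j ] j ∈ U × vertex j ≡ w
      along i∈ stop = _ , i∈ , refl
      along i∈ (step e walk) with closed i∈ e
      ... | j , j∈ , refl = along (proj₁ (edge j∈)) walk

    no-fresh-label : (∀ {i} → i ∈ U → Closed R vertex i) → ∀ {f} → f ∉ U → ⊥
    no-fresh-label closed {f} f∉ with injective⇒surjective {f = proj₁ ∘ labelled closed} inj f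
      where
      inj : Injective _≡_ _≡_ (proj₁ ∘ labelled closed)
      inj {x} {y} eq = trans (sym (proj₂ (proj₂ (labelled closed x))))
        (trans (cong vertex eq) (proj₂ (proj₂ (labelled closed y))))
    ... | w , refl = f∉ (proj₁ (proj₂ (labelled closed w)))

  module _ {U R vertex} (P : Partial [] U R vertex) where
    open Partial P

    used : ∀ i → i ∈ U
    used i with cover i
    ... | inj₂ i∈ = i∈

    all-used⇒onto : ∀ w → ∃[ i ] vertex i ≡ w
    all-used⇒onto = injective⇒surjective (injective (used _) (used _))

    closed⇒presentation : (∀ {i} → i ∈ U → Closed R vertex i) → Presentation G (lookup R)
    closed⇒presentation closed = record
      { vertex           = vertex
      ; vertex-injective = injective (used _) (used _)
      ; sound            = proj₂ ∘ edge
      ; complete         = complete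
      }
      where
      complete : ∀ {i j} → Adj (vertex i) (vertex j) → j ∈ lookup R i
      complete {i} {j} e with closed (used i) e
      ... | k , k∈ , eq = subst (_∈ lookup R i) (injective (used k) (used j) eq) k∈

  relabel : Fin n → Fin n → (Fin n → Fin n) → Fin n → Fin n
  relabel f w vertex i = if does (i ≟ f) then w else vertex i

  relabel-new : ∀ f w vertex → relabel f w vertex f ≡ w
  relabel-new f w vertex with f ≟ f
  ... | yes _  = refl
  ... | no f≢f = contradiction refl f≢f

  relabel-old : ∀ f w vertex {i} → i ≢ f → relabel f w vertex i ≡ vertex i
  relabel-old f w vertex {i} i≢f with i ≟ f
  ... | yes i≡f = contradiction i≡f i≢f
  ... | no _    = refl

  module _ {f F U R vertex w} (P : Partial (f ∷ F) U R vertex)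
    (w∉ : ∀ {i} → i ∈ U → vertex i ≢ w) where
    open Partial P

    f∉U : f ∉ U
    f∉U = All.head fresh∉used

    relabel-used : ∀ {i} → i ∈ U → relabel f w vertex i ≡ vertex i
    relabel-used i∈ = relabel-old f w vertex (λ { refl → f∉U i∈ })

    relabel-partial : Partial F (f ∷ U) R (relabel f w vertex)
    relabel-partial = record
      { fresh∉used   = extend (Unique[x∷xs]⇒x∉xs fresh-unique) (All.tail fresh∉used)
      ; fresh-unique = AllPairs.tail fresh-unique
      ; cover        = cover′
      ; injective    = injective′
      ; edge         = λ {i} {j} j∈ → there (proj₁ (edge j∈)) ,
          subst₂ Adj (sym (relabel-used (proj₁ (edge (symmetric j∈)))))
                     (sym (relabel-used (proj₁ (edge j∈)))) (proj₂ (edge j∈))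
      ; symmetric    = symmetric
      ; row-unique   = row-unique
      ; inhabited    = f , here refl
      }
      where
      extend : ∀ {xs} → f ∉ xs → All (_∉ U) xs → All (_∉ (f ∷ U)) xs
      extend f∉ []       = []
      extend f∉ (p ∷ ps) =
        (λ { (here refl) → f∉ (here refl) ; (there x∈) → p x∈ }) ∷ extend (f∉ ∘ there) ps
      cover′ : ∀ i → i ∈ F ⊎ i ∈ f ∷ U
      cover′ i with cover i
      ... | inj₁ (here refl) = inj₂ (here refl)
      ... | inj₁ (there i∈)  = inj₁ i∈
      ... | inj₂ i∈          = inj₂ (there i∈)
      injective′ : ∀ {i j} → i ∈ f ∷ U → j ∈ f ∷ U →
        relabel f w vertex i ≡ relabel f w vertex j → i ≡ j
      injective′ (here refl) (here refl) _  = refl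
      injective′ (here refl) (there j∈)  eq =
        contradiction (trans (sym (relabel-used j∈)) (trans (sym eq) (relabel-new f w vertex))) (w∉ j∈)
      injective′ (there i∈) (here refl)  eq =
        contradiction (trans (sym (relabel-used i∈)) (trans eq (relabel-new f w vertex))) (w∉ i∈)
      injective′ (there i∈) (there j∈)   eq =
        injective i∈ j∈ (trans (sym (relabel-used i∈)) (trans eq (relabel-used j∈)))

    relabel-closed : ∀ {i} → i ∈ U → Closed R vertex i → Closed R (relabel f w vertex) i
    relabel-closed i∈ closed e with closed (subst (λ v → Adj v _) (relabel-used i∈) e)
    ... | j , j∈ , eq = j , j∈ , trans (relabel-used (proj₁ (edge j∈))) eq

  addEdge-closed : ∀ i j R {vertex p} → Closed R vertex p → Closed (addEdge i j R) vertex p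
  addEdge-closed i j R closed e with closed e
  ... | k , k∈ , eq = k , addEdge⁺ i j R _ k∈ , eq

  explore-sound : ∀ k F U todo R vertex → T (explore k F U todo R) → Partial F U R vertex →
    (∀ {i} → i ∈ todo → i ∈ U) →
    (∀ {i} → i ∈ U → i ∈ todo ⊎ Closed R vertex i) → Goal

  row-sound : ∀ k F U todo i js R vertex → T (row k F U todo i js R) → Partial F U R vertex →
    (∀ {p} → p ∈ i ∷ todo → p ∈ U) →
    (∀ {p} → p ∈ U → p ∈ i ∷ todo ⊎ Closed R vertex p) →
    js ⊆ U →
    (∀ {j} → j ∈ U → Adj (vertex i) (vertex j) → j ∈ lookup R i ⊎ j ∈ js) → Goal

  branch-sound : ∀ k F U todo i js R vertex → T (branch k F U todo i js R) → Partial F U R vertex →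
    (∀ {p} → p ∈ i ∷ todo → p ∈ U) →
    (∀ {p} → p ∈ U → p ∈ i ∷ todo ⊎ Closed R vertex p) →
    js ⊆ U →
    (∀ {j} → j ∈ U → Adj (vertex i) (vertex j) → j ∈ lookup R i ⊎ j ∈ js) →
    length (lookup R i) ≢ r → Goal

  explore-sound (suc k) F U (i ∷ todo) R vertex ok P todo⊆ pending =
    row-sound k F U todo i U R vertex ok P todo⊆ pending id (λ j∈ _ → inj₂ j∈)
  explore-sound (suc k) [] U [] R vertex ok P todo⊆ pending =
    leaf-sound R (Equivalence.to T-≡ ok) (closed⇒presentation P ([ (λ ()) , id ]′ ∘ pending))
  explore-sound (suc k) (f ∷ F) U [] R vertex ok P todo⊆ pending =
    ⊥-elim (no-fresh-label P ([ (λ ()) , id ]′ ∘ pending) (All.head (Partial.fresh∉used P)))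

  row-sound k F U todo i js R vertex ok P todo⊆ pending js⊆ left with length (lookup R i) ≡ᵇ r in eq
  ... | false = branch-sound k F U todo i js R vertex ok P todo⊆ pending js⊆ left
    (λ full → subst T eq (≡⇒≡ᵇ _ _ full))
  ... | true = explore-sound k F U todo R vertex ok P (todo⊆ ∘ there) pending′
    where
    pending′ : ∀ {p} → p ∈ U → p ∈ todo ⊎ Closed R vertex p
    pending′ p∈ with pending p∈
    ... | inj₁ (here refl) = inj₂ (full⇒closed P (≡ᵇ⇒≡ _ _ (subst T (sym eq) _)))
    ... | inj₁ (there p∈′) = inj₁ p∈′
    ... | inj₂ closed      = inj₂ closed

  branch-sound k F U todo i (j ∷ js) R vertex ok P todo⊆ pending js⊆ left ¬full
    with i ≟ j | j ∈? lookup R i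
  ... | yes refl | _ = row-sound k F U todo i js R vertex ok P todo⊆ pending (js⊆ ∘ there) left′
    where
    left′ : ∀ {q} → q ∈ U → Adj (vertex i) (vertex q) → q ∈ lookup R i ⊎ q ∈ js
    left′ q∈ e with left q∈ e
    ... | inj₁ q∈′         = inj₁ q∈′
    ... | inj₂ (here refl) = ⊥-elim (adj-irrefl e)
    ... | inj₂ (there q∈′) = inj₂ q∈′
  ... | no _ | yes j∈R = row-sound k F U todo i js R vertex ok P todo⊆ pending (js⊆ ∘ there) left′
    where
    left′ : ∀ {q} → q ∈ U → Adj (vertex i) (vertex q) → q ∈ lookup R i ⊎ q ∈ js
    left′ q∈ e with left q∈ e
    ... | inj₁ q∈′         = inj₁ q∈′
    ... | inj₂ (here refl) = inj₁ j∈R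
    ... | inj₂ (there q∈′) = inj₂ q∈′
  ... | no i≢j | no j∉R with Equivalence.to T-∧ ok | T? (adj (vertex i) (vertex j))
  ...   | ok′ , _ | no ¬ij =
    row-sound k F U todo i js R vertex ok′ P todo⊆ pending (js⊆ ∘ there) left′
    where
    left′ : ∀ {q} → q ∈ U → Adj (vertex i) (vertex q) → q ∈ lookup R i ⊎ q ∈ js
    left′ q∈ e with left q∈ e
    ... | inj₁ q∈′         = inj₁ q∈′
    ... | inj₂ (here refl) = contradiction e ¬ij
    ... | inj₂ (there q∈′) = inj₂ q∈′
  ...   | _ , ok′ | yes ij with length (lookup R j) ≡ᵇ r in eq
  -- A full row `j` lists all neighbours, so it already contains `i`; by symmetry row `i` contains
  -- `j`.
  ...     | true = ⊥-elim (j∉R (Partial.symmetric P i∈R))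
    where
    i∈R : i ∈ lookup R j
    i∈R with full⇒closed P (≡ᵇ⇒≡ _ _ (subst T (sym eq) _)) (adj-sym ij)
    ... | q , q∈ , eq = subst (_∈ lookup R j)
      (Partial.injective P (proj₁ (Partial.edge P q∈)) (todo⊆ (here refl)) eq) q∈
  ...     | false = row-sound k F U todo i js (addEdge i j R) vertex ok′
    (addEdge-partial P (todo⊆ (here refl)) (js⊆ (here refl)) i≢j j∉R ij)
    todo⊆ (⊎-map id (addEdge-closed i j R) ∘ pending) (js⊆ ∘ there) left′
    where
    left′ : ∀ {q} → q ∈ U → Adj (vertex i) (vertex q) → q ∈ lookup (addEdge i j R) i ⊎ q ∈ js
    left′ q∈ e with left q∈ e
    ... | inj₁ q∈′         = inj₁ (addEdge⁺ i j R i q∈′)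
    ... | inj₂ (here refl) = inj₁ (addEdge-new i j R)
    ... | inj₂ (there q∈′) = inj₂ q∈′
  branch-sound k F U todo i [] R vertex ok P todo⊆ pending js⊆ left ¬full
    with new-neighbour P ¬full
  ... | w , iw , w∉R = label F ok P
    where
    -- `js` is exhausted, so every used neighbour is listed and the unlisted `w` has no label yet.
    w∉ : ∀ {q} → q ∈ U → vertex q ≢ w
    w∉ q∈ refl with left q∈ iw
    ... | inj₁ q∈R = w∉R (∈-map⁺ vertex q∈R)

    label : ∀ F → T (branch k F U todo i [] R) → Partial F U R vertex → Goal
    label []      _  P = ⊥-elim (w∉ (used P _) (proj₂ (all-used⇒onto P w)))
    label (f ∷ F) ok P = row-sound k F (f ∷ U) (todo ∷ʳ f) i [] (addEdge i f R) vertex′ ok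
      (addEdge-partial P′ (there i∈) (here refl) i≢f (f∉ ∘ proj₁ ∘ Partial.edge P) if-adj)
      todo⊆′ pending′ (λ ()) left′
      where
      vertex′ = relabel f w vertex
      P′ = relabel-partial P w∉
      f∉ = f∉U P w∉
      i∈ = todo⊆ (here refl)

      i≢f : i ≢ f
      i≢f refl = f∉ i∈

      if-adj : Adj (vertex′ i) (vertex′ f)
      if-adj = subst₂ Adj (sym (relabel-used P w∉ i∈)) (sym (relabel-new f w vertex)) iw

      todo⊆′ : ∀ {p} → p ∈ i ∷ (todo ∷ʳ f) → p ∈ f ∷ U
      todo⊆′ (here refl) = there i∈
      todo⊆′ (there p∈) with ∈-++⁻ todo p∈
      ... | inj₁ p∈′         = there (todo⊆ (there p∈′))
      ... | inj₂ (here refl) = here refl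

      pending′ : ∀ {p} → p ∈ f ∷ U → p ∈ i ∷ (todo ∷ʳ f) ⊎ Closed (addEdge i f R) vertex′ p
      pending′ (here refl) = inj₁ (there (∈-++⁺ʳ todo (here refl)))
      pending′ (there p∈) with pending p∈
      ... | inj₁ (here refl) = inj₁ (here refl)
      ... | inj₁ (there p∈′) = inj₁ (there (∈-++⁺ˡ p∈′))
      ... | inj₂ closed      = inj₂ (addEdge-closed i f R (relabel-closed P w∉ p∈ closed))

      left′ : ∀ {q} → q ∈ f ∷ U → Adj (vertex′ i) (vertex′ q) → q ∈ lookup (addEdge i f R) i ⊎ q ∈ []
      left′ (here refl) _ = inj₁ (addEdge-new i f R)
      left′ (there q∈) e with left q∈ (subst₂ Adj (relabel-used P w∉ i∈) (relabel-used P w∉ q∈) e)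
      ... | inj₁ q∈R = inj₁ (addEdge⁺ i f R i q∈R)

search-sound : ∀ {n r} (G : Graph (suc n)) → Regular G r → (∀ u v → Reachable G u v) →
  (leaf : Rows (suc n) → Bool) {Goal : Set} →
  (∀ R → leaf R ≡ true → Presentation G (lookup R) → Goal) → search r leaf ≡ true → Goal
search-sound {n} {r} G regular connected leaf leaf-sound ok =
  -- Vertex zero serves as the root; the constant map matters only at label zero.
  explore-sound (2 + n) (map suc (allFin n)) (zero ∷ []) (zero ∷ []) (replicate _ []) (λ _ → zero)
    (Equivalence.from T-≡ ok)
    (record
      { fresh∉used   = All.tabulate fresh∉
      ; fresh-unique = map⁺ suc-injective (allFin⁺ n)
      ; cover        = λ { zero → inj₂ (here refl) ; (suc i) → inj₁ (∈-map⁺ suc (∈-allFin i)) }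
      ; injective    = λ { (here refl) (here refl) _ → refl }
      ; edge         = λ {i} j∈ → ⊥-elim (empty i j∈)
      ; symmetric    = λ {i} j∈ → ⊥-elim (empty i j∈)
      ; row-unique   = λ i → subst Unique (sym (lookup-replicate i [])) []
      ; inhabited    = zero , here refl
      })
    id inj₁
  where
  open SearchSound G regular connected leaf leaf-sound
  empty : ∀ i {j} → j ∉ lookup (replicate (suc n) []) i
  empty i j∈ with subst (_ ∈_) (lookup-replicate i []) j∈
  ... | ()
  fresh∉ : ∀ {i} → i ∈ map suc (allFin n) → i ∉ zero ∷ []
  fresh∉ i∈ (here refl) with ∈-map⁻ suc i∈
  ... | _ , _ , ()

-- Euler's formula for cubic graphs

length-filter-map : ∀ {A B : Set} {P : Pred B 0ℓ} (P? : Decidable P) (f : A → B) xs →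
  length (filter P? (map f xs)) ≡ length (filter (P? ∘ f) xs)
length-filter-map P? f []       = refl
length-filter-map P? f (x ∷ xs) with does (P? (f x))
... | true  = cong suc (length-filter-map P? f xs)
... | false = length-filter-map P? f xs

length-filter-product : ∀ {A B : Set} {P : Pred (A × B) 0ℓ} (P? : Decidable P) {ys r} →
  (∀ x → length (filter (P? ∘ (x ,_)) ys) ≡ r) →
  ∀ xs → length (filter P? (cartesianProduct xs ys)) ≡ length xs * r
length-filter-product P?      const []       = refl
length-filter-product P? {ys} const (x ∷ xs) =
  trans (cong length (filter-++ P? (map (x ,_) ys) _))
  (trans (length-++ (filter P? (map (x ,_) ys)))
  (cong₂ _+_ (trans (length-filter-map P? (x ,_) ys) (const x))
             (length-filter-product P? const xs)))

module _ {n : ℕ} (G : Graph n) where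
  open Graph G

  -- Every ordered adjacent pair is an edge in increasing order or the swap of one.
  handshake : ∀ {r} → Regular G r → n * r ≤ 2 * edgeCount G
  handshake {r} regular = ≤-trans (≤-reflexive (sym ends-length))
    (≤-trans (unique-⊆-length ends-unique ends⊆)
             (≤-reflexive (trans (length-++ edges)
               (cong (length edges +_) (trans (length-map swap edges) (sym (+-identityʳ _)))))))
    where
    end? : Decidable (λ ((u , v) : Fin n × Fin n) → Adj u v)
    end? (u , v) = T? (adj u v)

    edge? : Decidable (λ ((u , v) : Fin n × Fin n) → u Fin.< v × Adj u v)
    edge? (u , v) = (u Fin.<? v) ×-dec T? (adj u v)

    pairs edges ends : List (Fin n × Fin n)
    pairs = cartesianProduct (allFin n) (allFin n)
    edges = filter edge? pairs
    ends  = filter end? pairs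

    ∈-pairs : ∀ {u v} → (u , v) ∈ pairs
    ∈-pairs {u} {v} = ∈-cartesianProduct⁺ (∈-allFin u) (∈-allFin v)

    ends-unique : Unique ends
    ends-unique = filter⁺ end? (cartesianProduct⁺ (allFin⁺ n) (allFin⁺ n))

    ends-length : length ends ≡ n * r
    ends-length = trans (length-filter-product end? regular (allFin n))
                        (cong (_* r) (length-tabulate (id {A = Fin n})))

    ends⊆ : ends ⊆ edges ++ map swap edges
    ends⊆ {u , v} uv∈ with proj₂ (∈-filter⁻ end? {xs = pairs} uv∈) | <-cmp u v
    ... | uv | tri< u<v _ _  = ∈-++⁺ˡ (∈-filter⁺ edge? ∈-pairs (u<v , uv))
    ... | uv | tri≈ _ refl _ = ⊥-elim (adj-irrefl uv)
    ... | uv | tri> _ _ v<u  =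
      ∈-++⁺ʳ edges (∈-map⁺ swap (∈-filter⁺ edge? ∈-pairs (v<u , adj-sym uv)))

  no-isolated : ∀ {r} → Regular G (suc r) → isolatedCount G ≡ 0
  no-isolated regular = cong length (filter-none (λ v → degree G v ℕ.≟ 0)
    (All.universal (λ v eq → contradiction (trans (sym (regular v)) eq) (λ ())) (allFin n)))

module _ {n : ℕ} (G : Graph (suc n)) where

  -- Doubling V + F = E + 2C and inserting 3V ≤ 2E and C ≥ 1 leaves V + 4 ≤ 2F, so ten vertices
  -- force seven faces.
  cubic-faces : Regular G 3 → ((S , f , _) : Planar G) → suc n + 4 ≤ 2 * f
  cubic-faces regular (S , f , c , _ , (component , _) , euler) =
    +-cancelˡ-≤ (2 * suc n) _ _ (begin
      2 * suc n + (suc n + 4)                     ≡⟨ lhs (suc n) ⟩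
      suc n * 3 + 4 * 1                           ≤⟨ +-monoˡ-≤ _ (handshake G regular) ⟩
      2 * edgeCount G + 4 * 1                     ≤⟨ +-monoʳ-≤ (2 * edgeCount G) (*-monoʳ-≤ 4 (nonempty (component zero))) ⟩
      2 * edgeCount G + 4 * c                     ≡⟨ mid (edgeCount G) c ⟩
      2 * (edgeCount G + 2 * c)                   ≡⟨ cong (2 *_) (sym euler) ⟩
      2 * (suc n + (f + isolatedCount G))         ≡⟨ cong (λ i → 2 * (suc n + (f + i))) (no-isolated G regular) ⟩
      2 * (suc n + (f + 0))                       ≡⟨ rhs (suc n) f ⟩
      2 * suc n + 2 * f                           ∎)
    where
    open ≤-Reasoning
    nonempty : ∀ {k} → Fin k → 1 ≤ k
    nonempty zero    = s≤s z≤n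
    nonempty (suc _) = s≤s z≤n
    lhs : ∀ n → 2 * n + (n + 4) ≡ n * 3 + 4 * 1
    lhs = solve-∀
    mid : ∀ e c → 2 * e + 4 * c ≡ 2 * (e + 2 * c)
    mid = solve-∀
    rhs : ∀ n f → 2 * (n + (f + 0)) ≡ 2 * n + 2 * f
    rhs = solve-∀

-- Rotation systems of cubic graphs and their faces

turn : Bool → Fin 3 → Fin 3
turn true  0F = 1F
turn true  1F = 2F
turn true  2F = 0F
turn false 0F = 2F
turn false 1F = 0F
turn false 2F = 1F

-- Transitivity is phrased as an induction principle. Every self-map of three points has a cycle;
-- one of length 1 or 2 would be a proper closed subset, so `σ` is one of the two 3-cycles.
transitive⇒turn : (σ : Fin 3 → Fin 3) →
  (∀ (Q : Fin 3 → Set) → (∀ {k} → Q k → Q (σ k)) → ∀ {k} → Q k → ∀ l → Q l) →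
  ∃[ b ] ∀ k → σ k ≡ turn b k
transitive⇒turn σ spread = cases (σ 0F) (σ 1F) (σ 2F) refl refl refl
  where
  no-fixed : ∀ {k} → σ k ≡ k → ⊥
  no-fixed {k} fix with trans (only 0F) (sym (only 1F))
    where
    only : ∀ l → l ≡ k
    only = spread (_≡ k) (λ { refl → fix }) refl
  ... | ()

  no-swap : ∀ {j k} l → l ≢ j → l ≢ k → σ j ≡ k → σ k ≡ j → ⊥
  no-swap {j} {k} l l≢j l≢k jk kj = [ l≢j , l≢k ]′
    (spread (λ x → x ≡ j ⊎ x ≡ k) (λ { (inj₁ refl) → inj₂ jk ; (inj₂ refl) → inj₁ kj }) (inj₁ refl) l)

  cases : ∀ a b c → σ 0F ≡ a → σ 1F ≡ b → σ 2F ≡ c → ∃[ d ] ∀ k → σ k ≡ turn d k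
  cases 1F 2F 0F p q r = true  , λ { 0F → p ; 1F → q ; 2F → r }
  cases 2F 0F 1F p q r = false , λ { 0F → p ; 1F → q ; 2F → r }
  cases 0F _  _  p q r = ⊥-elim (no-fixed p)
  cases _  1F _  p q r = ⊥-elim (no-fixed q)
  cases _  _  2F p q r = ⊥-elim (no-fixed r)
  cases 1F 0F _  p q r = ⊥-elim (no-swap 2F (λ ()) (λ ()) p q)
  cases 2F _  0F p q r = ⊥-elim (no-swap 1F (λ ()) (λ ()) p r)
  cases _  2F 1F p q r = ⊥-elim (no-swap 0F (λ ()) (λ ()) q r)

Table : ℕ → Set
Table n = Vec (Vec (Fin n) 3) n

rows : ∀ {n} → Table n → Fin n → List (Fin n)
rows t i = toList (lookup t i)

Distinct : ∀ {n} → Table n → Set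
Distinct t = ∀ i k l → lookup (lookup t i) k ≡ lookup (lookup t i) l → k ≡ l

position : ∀ {n m} → Fin n → Vec (Fin n) (suc m) → Fin (suc m)
-- The last position is the default, so that evaluation carries no membership proof.
position {m = zero}  i xs       = zero
position {m = suc m} i (x ∷ xs) = if does (i ≟ x) then zero else suc (position i xs)

lookup-position : ∀ {n m} (i : Fin n) (xs : Vec (Fin n) (suc m)) → i ∈ toList xs →
  lookup xs (position i xs) ≡ i
lookup-position {m = zero}  i (x ∷ []) (Any.here refl) = refl
lookup-position {m = suc m} i (x ∷ xs) i∈ with i ≟ x
... | yes refl = refl
... | no i≢x with i∈
...   | Any.here i≡x  = contradiction i≡x i≢x
...   | Any.there i∈′ = lookup-position i xs i∈′

allVectors : ∀ n → (Vec Bool n → Bool) → Bool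
allVectors zero    P = P []
allVectors (suc n) P = allVectors n (P ∘ (true ∷_)) ∧ allVectors n (P ∘ (false ∷_))

allVectors-sound : ∀ {n} (P : Vec Bool n → Bool) → T (allVectors n P) → ∀ b → T (P b)
allVectors-sound P ok []          = ok
allVectors-sound P ok (true ∷ b)  = allVectors-sound _ (proj₁ (Equivalence.to T-∧ ok)) b
allVectors-sound P ok (false ∷ b) = allVectors-sound _ (proj₂ (Equivalence.to T-∧ ok)) b

-- The dart (i , k) leads from i to the k-th entry of its row.
Code : ℕ → Set
Code n = Fin n × Fin 3

key : ∀ {n} → Code n → ℕ
key (i , k) = 3 * toℕ i + toℕ k

Reversal : ℕ → Set
Reversal n = Vec (Vec (Code n) 3) n

rotate : ∀ {n} → Vec Bool n → Code n → Code n
rotate b (i , k) = i , turn (lookup b i) k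

-- The successor table is an argument so that evaluation shares it.
module Faces {n : ℕ} (successor : Vec (Vec (Code n) 3) n) where
  next : Code n → Code n
  next (i , k) = lookup (lookup successor i) k

  -- Follows the face until a key below `s` appears or `s` recurs. A spurious `true`, as on
  -- exhausted fuel, is harmless: it only lengthens `leaders`, which serves as an upper bound for
  -- the faces.
  leads : ℕ → ℕ → Code n → Bool
  leads zero    s x = true
  leads (suc m) s x = if key x <ᵇ s then false else if key x ≡ᵇ s then true else leads m s (next x)

  codes leaders : List (Code n)
  codes   = cartesianProduct (allFin n) (allFin 3)
  leaders = filterᵇ (λ x → leads (3 * n) (key x) (next x)) codes

reversal : ∀ {n} → Table n → Reversal n
reversal t = tabulate λ i → Vec.map (λ j → j , position i (lookup t j)) (lookup t i)

-- The negation of the bound in `cubic-faces`, with leaders in place of faces.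
fewLeaders : ∀ {n} → Reversal n → Vec Bool n → Bool
fewLeaders {n} rev b = 2 * length (Faces.leaders (Vec.map (Vec.map (rotate b)) rev)) <ᵇ n + 4

-- A rotation system on a cubic graph is one choice of orientation per vertex.
-- Every face has a leader, its dart of least key.
fewFaces : ∀ {n} → Table n → Bool
fewFaces t = allVectors _ (fewLeaders (reversal t))

module Rotation {n : ℕ} {G : Graph n} (t : Table n) (P : Presentation G (rows t))
  (distinct : Distinct t)
  (S : RotationSystem G) where

  open Graph G
  open Presentation P
  open RotationSystem S
  open Dart

  dart-≡ : ∀ {d e : Dart G} → src d ≡ src e → tgt d ≡ tgt e → d ≡ e
  dart-≡ {dart u v d} {dart _ _ e} refl refl = cong (dart u v) (T-irrelevant d e)

  ⟦_⟧ : Code n → Dart G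
  ⟦ i , k ⟧ = dart (vertex i) (vertex (lookup (lookup t i) k))
                   (sound (∈-toList⁺ (∈-lookup k (lookup t i))))

  ⟦⟧-onto : ∀ i (d : Dart G) → src d ≡ vertex i → ∃[ k ] ⟦ i , k ⟧ ≡ d
  ⟦⟧-onto i (dart _ v e) refl with injective⇒surjective vertex-injective v
  ... | j , refl = position j (lookup t i) ,
    dart-≡ refl (cong vertex (lookup-position j (lookup t i) (complete e)))

  private
    σ-exists : ∀ i k → ∃[ l ] ⟦ i , l ⟧ ≡ rot ⟦ i , k ⟧
    σ-exists i k = ⟦⟧-onto i (rot ⟦ i , k ⟧) (rot-src ⟦ i , k ⟧)

    σ : Fin n → Fin 3 → Fin 3
    σ i k = proj₁ (σ-exists i k)

    spread : ∀ i (Q : Fin 3 → Set) → (∀ {k} → Q k → Q (σ i k)) → ∀ {k} → Q k → ∀ l → Q l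
    spread i Q preserved {k} q l with rot-cyclic ⟦ i , k ⟧ ⟦ i , l ⟧ refl
    ... | m , reach = along m q reach
      where
      along : ∀ m {k} → Q k → iterate rot ⟦ i , k ⟧ m ≡ ⟦ i , l ⟧ → Q l
      -- Equal darts have equal targets, and a row without repetitions determines the position from
      -- the target.
      along zero        q eq = subst Q (distinct i _ _ (vertex-injective (cong tgt eq))) q
      along (suc m) {k} q eq =
        along m (preserved q) (trans (cong (λ d → iterate rot d m) (proj₂ (σ-exists i k))) eq)

    orientation : ∀ i → ∃[ b ] ∀ k → σ i k ≡ turn b k
    orientation i = transitive⇒turn (σ i) (spread i)

  orientations : Vec Bool n
  orientations = tabulate (proj₁ ∘ orientation)

  open Faces (Vec.map (Vec.map (rotate orientations)) (reversal t))

  rot-⟦⟧ : ∀ i k → rot ⟦ i , k ⟧ ≡ ⟦ i , turn (lookup orientations i) k ⟧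
  rot-⟦⟧ i k = trans (sym (proj₂ (σ-exists i k))) (cong (λ l → ⟦ i , l ⟧)
    (trans (proj₂ (orientation i) k)
           (cong (λ b → turn b k) (sym (lookup∘tabulate (proj₁ ∘ orientation) i)))))

  reverse-⟦⟧ : ∀ i k → reverse G ⟦ i , k ⟧ ≡ ⟦ lookup (lookup (reversal t) i) k ⟧
  reverse-⟦⟧ i k = trans (dart-≡ refl (cong vertex (sym (lookup-position i (lookup t j) i∈))))
    (cong ⟦_⟧ (sym (trans (cong (λ r → lookup r k) (lookup∘tabulate _ i))
                          (lookup-map k _ (lookup t i)))))
    where
    j = lookup (lookup t i) k
    i∈ : i ∈ rows t j
    i∈ = complete (adj-sym (Dart.edge ⟦ i , k ⟧))

  faceNext-⟦⟧ : ∀ x → faceNext ⟦ x ⟧ ≡ ⟦ next x ⟧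
  faceNext-⟦⟧ (i , k) = trans (cong rot (reverse-⟦⟧ i k)) (trans (uncurry rot-⟦⟧ _)
    (cong ⟦_⟧ (sym (trans
      (cong (λ r → lookup r k) (lookup-map i (Vec.map (rotate orientations)) (reversal t)))
      (lookup-map k (rotate orientations) (lookup (reversal t) i))))))

  same-face : ∀ m x → SameFace ⟦ x ⟧ ⟦ iterate next x m ⟧
  same-face zero    x = 0 , refl
  same-face (suc m) x with same-face m (next x)
  ... | k , eq = suc k , trans (cong (λ d → iterate faceNext d k) (faceNext-⟦⟧ x)) eq

  ¬leads : ∀ m s x → ¬ T (leads m s x) → ∃[ k ] key (iterate next x k) < s
  ¬leads zero    s x ¬ok = contradiction _ ¬ok
  ¬leads (suc m) s x ¬ok with key x <ᵇ s in eq
  ... | true  = 0 , <ᵇ⇒< _ _ (subst T (sym eq) _)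
  ... | false with key x ≡ᵇ s
  ...   | true  = contradiction _ ¬ok
  ...   | false with ¬leads m s (next x) ¬ok
  ...     | k , k< = suc k , k<

  -- Descent on keys: a dart that does not lead has a dart of smaller key further along its face.
  face-leader : ∀ x → Acc _<_ (key x) → ∃[ y ] y ∈ leaders × ∃[ m ] y ≡ iterate next x m
  face-leader x (acc smaller) with T? (leads (3 * n) (key x) (next x))
  ... | yes ok = x , ∈-filter⁺ _ (∈-cartesianProduct⁺ (∈-allFin _) (∈-allFin _)) ok , 0 , refl
  ... | no ¬ok with ¬leads (3 * n) (key x) (next x) ¬ok
  ...   | m , m< with face-leader (iterate next (next x) m) (smaller m<)
  ...     | y , y∈ , k , y≡ = y , y∈ , suc m + k , trans y≡ (sym (iterate-+ (suc m) x))
    where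
    iterate-+ : ∀ m x → iterate next x (m + k) ≡ iterate next (iterate next x m) k
    iterate-+ zero    x = refl
    iterate-+ (suc m) x = iterate-+ m (next x)

  faces≤leaders : ∀ {f} → HasClasses SameFace f → f ≤ length leaders
  faces≤leaders {f} (class , onto , classes) =
    ≤-trans (≤-reflexive (sym (length-tabulate (id {A = Fin f}))))
    (≤-trans (unique-⊆-length (allFin⁺ f) covered) (≤-reflexive (length-map (class ∘ ⟦_⟧) leaders)))
    where
    covered : allFin f ⊆ map (class ∘ ⟦_⟧) leaders
    covered {q} _ with onto q
    ... | d , d↦q with injective⇒surjective vertex-injective (src d)
    ...   | i , i↦ with ⟦⟧-onto i d (sym i↦)
    ...     | k , refl with face-leader (i , k) (<-wellFounded _)
    ...       | y , y∈ , m , refl = subst (_∈ map (class ∘ ⟦_⟧) leaders)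
      (trans (sym (Equivalence.to (classes _ _) (same-face m (i , k)))) (d↦q refl))
      (∈-map⁺ (class ∘ ⟦_⟧) y∈)

nonplanar : ∀ {n} (G : Graph (suc n)) (t : Table (suc n)) → Presentation G (rows t) →
  Distinct t →
  fewFaces t ≡ true → Regular G 3 → ¬ Planar G
nonplanar {n} G t P distinct few regular planar@(S , f , _ , faces , _) =
  n≮n (2 * f) (≤-trans (s≤s (*-monoʳ-≤ 2 (faces≤leaders faces)))
    (≤-trans (<ᵇ⇒< (2 * length leaders) _
                (allVectors-sound (fewLeaders (reversal t)) (Equivalence.from T-≡ few) orientations))
             (cubic-faces G regular planar)))
  where
  open Rotation t P distinct S
  open Faces (Vec.map (Vec.map (rotate orientations)) (reversal t))

-- Decidable tests at the leaves of the search

module _ {n : ℕ} (R : Rows n) where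
  open DecMembership (_≟_ {n}) using (_∈?_)

  -- `DartInjective` over row entries instead of adjacency proofs, which makes it decidable by
  -- finite checks.
  RowInjective : ∀ {k} → (Fin n → Fin k) → Set
  RowInjective c = ∀ u x → c u ≡ c x →
    All (λ v → All (λ y → c v ≡ c y → u ≡ x × v ≡ y) (lookup R x)) (lookup R u)

  rowInjective? : ∀ {k} (c : Fin n → Fin k) → Dec (RowInjective c)
  rowInjective? c = all? λ u → all? λ x → (c u ≟ c x) →-dec
    All.all? (λ v → All.all? (λ y → (c v ≟ c y) →-dec ((u ≟ x) ×-dec (v ≟ y))) (lookup R x)) (lookup R u)

  rowInjective⇒harmonious : ∀ {k} {G : Graph n} {c : Fin n → Fin k} →
    Presentation G (lookup R) → RowInjective c → HarmoniouslyColorable G k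
  rowInjective⇒harmonious {G = G} {c} P inj = c ∘ label , dartInjective⇒harmonious G dart-inj
    where
    open Graph G
    open Presentation P
    onto : ∀ v → ∃[ i ] vertex i ≡ v
    onto = injective⇒surjective vertex-injective
    label : Fin n → Fin n
    label = proj₁ ∘ onto
    row : ∀ {u v} → Adj u v → label v ∈ lookup R (label u)
    row {u} {v} uv = complete (subst₂ Adj (sym (proj₂ (onto u))) (sym (proj₂ (onto v))) uv)
    vertex-label : ∀ {u v} → label u ≡ label v → u ≡ v
    vertex-label {u} {v} eq = trans (sym (proj₂ (onto u))) (trans (cong vertex eq) (proj₂ (onto v)))
    dart-inj : DartInjective G (c ∘ label)
    dart-inj uv xy cu≡cx cv≡cy with All.lookup (All.lookup (inj _ _ cu≡cx) (row uv)) (row xy) cv≡cy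
    ... | eq₁ , eq₂ = vertex-label eq₁ , vertex-label eq₂

  -- `π` is an isomorphism from `t` to `R`: injective, preserving and reflecting adjacency.
  Embeds : Table n → Vec (Fin n) n → Set
  Embeds t π =
    (∀ i j → lookup π i ≡ lookup π j → i ≡ j) ×
    (∀ i → All (λ j → lookup π j ∈ lookup R (lookup π i)) (rows t i)) ×
    (∀ i j → lookup π j ∈ lookup R (lookup π i) → j ∈ rows t i)

  embeds? : ∀ t π → Dec (Embeds t π)
  embeds? t π =
    (all? λ i → all? λ j → (lookup π i ≟ lookup π j) →-dec (i ≟ j)) ×-dec
    (all? λ i → All.all? (λ j → lookup π j ∈? lookup R (lookup π i)) (rows t i)) ×-dec
    (all? λ i → all? λ j → (lookup π j ∈? lookup R (lookup π i)) →-dec (j ∈? rows t i))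

  embeds⇒presentation : ∀ {G : Graph n} {t π} → Presentation G (lookup R) → Embeds t π →
    Presentation G (rows t)
  embeds⇒presentation {π = π} P (inj , into , back) = record
    { vertex           = vertex ∘ lookup π
    ; vertex-injective = inj _ _ ∘ vertex-injective
    ; sound            = sound ∘ All.lookup (into _)
    ; complete         = back _ _ ∘ complete
    }
    where open Presentation P

  ball : ℕ → Fin n → List (Fin n)
  ball zero    i = i ∷ []
  ball (suc d) i = i ∷ concatMap (ball d) (lookup R i)

  walk-in-ball : ∀ {G : Graph n} (P : Presentation G (lookup R)) → let open Presentation P in
    ∀ {d k i j} → Walk G (vertex i) (vertex j) k → k ≤ d → j ∈ ball d i
  walk-in-ball {G} P {d} {i = i} {j} w k≤d = along w k≤d refl
    where
    open Graph G
    open Presentation P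
    along : ∀ {u k d i} → Walk G u (vertex j) k → k ≤ d → u ≡ vertex i → j ∈ ball d i
    along {d = zero}  stop _ eq = here (vertex-injective eq)
    along {d = suc d} stop _ eq = here (vertex-injective eq)
    along {d = suc d} {i} (step {v = v} e w) (s≤s k≤d) refl
      with injective⇒surjective vertex-injective v
    ... | l , refl = there (∈-concatMap⁺ (ball d) (Any.map (λ { refl → along w k≤d refl }) (complete e)))

  -- By `walk-in-ball` a label outside the ball certifies a diameter greater than `d`.
  Remote : ℕ → Set
  Remote d = ∃[ i ] ∃[ j ] j ∉ ball d i

  remote? : ∀ d → Dec (Remote d)
  remote? d = any? λ i → any? λ j → ¬? (j ∈? ball d i)

-- Nothing is proved about farPairs, colouring and embeddings: their results are
-- only candidates, tested with rowInjective? and embeds?.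
module _ {n : ℕ} (R : Rows n) where
  open DecMembership (_≟_ {n}) using (_∈?_)

  private
    disjoint : List (Fin n) → List (Fin n) → Bool
    disjoint xs ys = all (λ x → not (does (x ∈? ys))) xs

  -- Disjoint closed neighbourhoods mean distance at least 3.
  farPairs : List (List (Fin n))
  farPairs = map (λ (u , v) → u ∷ v ∷ [])
    (filterᵇ (λ (u , v) → (toℕ u <ᵇ toℕ v) ∧ disjoint (u ∷ lookup R u) (v ∷ lookup R v))
             (cartesianProduct (allFin n) (allFin n)))

  compatible : List (Fin n) → List (Fin n) → Bool
  compatible p q = disjoint p q ∧
    (length (filterᵇ (λ (x , y) → does (y ∈? lookup R x)) (cartesianProduct p q)) ≤ᵇ 1)

  cliques : ℕ → List (List (Fin n)) → List (List (List (Fin n)))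
  cliques zero    ps       = [] ∷ []
  cliques (suc k) []       = []
  cliques (suc k) (p ∷ ps) = map (p ∷_) (cliques k (filterᵇ (compatible p) ps)) ++ cliques (suc k) ps

  -- On ten vertices three disjoint pairs leave four singletons, hence seven classes.
  colouring : ∀ {k} → List (List (Fin n)) → Vec (Fin (suc k)) n
  colouring {k} pairs = tabulate (λ x → colour x (zip (allFin (suc k)) classes))
    where
    classes : List (List (Fin n))
    classes = pairs ++ map (_∷ []) (filterᵇ (λ x → all (λ p → not (does (x ∈? p))) pairs) (allFin n))
    colour : Fin n → List (Fin (suc k) × List (Fin n)) → Fin (suc k)
    colour x []             = zero
    colour x ((i , p) ∷ ps) = if does (x ∈? p) then i else colour x ps

  module _ (t : Table n) where
    private
      Placement = List (Fin n × Fin n)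

      image : Fin n → Placement → Fin n
      image i []             = i
      image i ((j , x) ∷ pl) = if does (i ≟ j) then x else image i pl

      -- The first entry of a row of t, except row 0, is assumed to be an earlier label.
      candidates : Fin n → Placement → List (Fin n)
      candidates i []         = allFin n
      candidates i pl@(_ ∷ _) = lookup R (image (lookup (lookup t i) 0F) pl)

      consistent : Fin n → Placement → Fin n → Bool
      consistent i pl x = all (λ (j , y) →
        not (does (x ≟ y)) ∧ not (does (j ∈? rows t i) xor does (y ∈? lookup R x))) pl

      place : List Placement → Fin n → List Placement
      place pls i = concatMap (λ pl →
        map (λ x → (i , x) ∷ pl) (filterᵇ (consistent i pl) (candidates i pl))) pls

    embeddings : List (Vec (Fin n) n)
    embeddings = map (λ pl → tabulate (λ i → image i pl)) (foldl place ([] ∷ []) (allFin n))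

module _ {n k : ℕ} (colourings : Rows n → List (Vec (Fin k) n))
  (embeddings : Rows n → Table n → List (Vec (Fin n) n)) (tables : List (Table n)) (d : ℕ) where

  -- The generators of candidates are parameters: soundness holds whatever they return.
  solved : Rows n → Bool
  solved R = any (λ c → ⌊ rowInjective? R (lookup c) ⌋) (colourings R)
           ∨ any (λ t → any (λ π → ⌊ embeds? R t π ⌋) (embeddings R t)) tables
           ∨ ⌊ remote? R d ⌋

  solved-sound : (G : Graph n) → (∀ u v → ∃[ l ] Walk G u v l × l ≤ d) →
    All (λ t → ¬ Presentation G (rows t)) tables →
    ∀ R → solved R ≡ true → Presentation G (lookup R) → HarmoniouslyColorable G k
  solved-sound G near obstruct R ok P
    with Equivalence.to (T-∨ {any (λ c → ⌊ rowInjective? R (lookup c) ⌋) (colourings R)})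
                        (Equivalence.from T-≡ ok)
  ... | inj₁ coloured with Any.satisfied (any⁻ _ (colourings R) coloured)
  ...   | c , inj = rowInjective⇒harmonious R P (toWitness {a? = rowInjective? R (lookup c)} inj)
  solved-sound G near obstruct R ok P | inj₂ ok′
    with Equivalence.to (T-∨ {any (λ t → any (λ π → ⌊ embeds? R t π ⌋) (embeddings R t)) tables}) ok′
  ... | inj₁ obstructed with find (any⁻ _ tables obstructed)
  ...   | t , t∈ , embedded with Any.satisfied (any⁻ _ (embeddings R t) embedded)
  ...     | π , embeds = ⊥-elim (All.lookup obstruct t∈
    (embeds⇒presentation R {t = t} {π} P (toWitness {a? = embeds? R t π} embeds)))
  solved-sound G near obstruct R ok P | inj₂ ok′ | inj₂ remote with toWitness {a? = remote? R d} remote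
  ... | i , j , j∉ with near (vertex i) (vertex j)
    where open Presentation P
  ...   | l , walk , l≤d = ⊥-elim (j∉ (walk-in-ball R P walk l≤d))

-- The seven exceptional graphs and the evaluation of the search

_·_·_ : ∀ {A : Set} → A → A → A → Vec A 3
a · b · c = a ∷ b ∷ c ∷ []

-- t₇ is the Petersen graph.
t₁ : Table 10
t₁ =
  (1F · 2F · 3F) ∷ (0F · 2F · 4F) ∷ (0F · 1F · 5F) ∷ (0F · 6F · 7F) ∷ (1F · 6F · 8F) ∷
  (2F · 7F · 9F) ∷ (3F · 4F · 9F) ∷ (3F · 5F · 8F) ∷ (4F · 7F · 9F) ∷ (5F · 6F · 8F) ∷ []

t₂ : Table 10
t₂ =
  (1F · 2F · 3F) ∷ (0F · 4F · 5F) ∷ (0F · 4F · 6F) ∷ (0F · 5F · 7F) ∷ (1F · 2F · 8F) ∷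
  (1F · 3F · 9F) ∷ (2F · 7F · 9F) ∷ (3F · 6F · 8F) ∷ (4F · 7F · 9F) ∷ (5F · 6F · 8F) ∷ []

t₃ : Table 10
t₃ =
  (1F · 2F · 3F) ∷ (0F · 4F · 5F) ∷ (0F · 4F · 6F) ∷ (0F · 7F · 8F) ∷ (1F · 2F · 7F) ∷
  (1F · 8F · 9F) ∷ (2F · 8F · 9F) ∷ (3F · 4F · 9F) ∷ (3F · 5F · 6F) ∷ (5F · 6F · 7F) ∷ []

t₄ : Table 10
t₄ =
  (1F · 2F · 3F) ∷ (0F · 2F · 4F) ∷ (0F · 1F · 5F) ∷ (0F · 6F · 7F) ∷ (1F · 6F · 7F) ∷
  (2F · 8F · 9F) ∷ (3F · 4F · 8F) ∷ (3F · 4F · 9F) ∷ (5F · 6F · 9F) ∷ (5F · 7F · 8F) ∷ []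

t₅ : Table 10
t₅ =
  (1F · 2F · 3F) ∷ (0F · 2F · 4F) ∷ (0F · 1F · 5F) ∷ (0F · 6F · 7F) ∷ (1F · 6F · 8F) ∷
  (2F · 6F · 9F) ∷ (3F · 4F · 5F) ∷ (3F · 8F · 9F) ∷ (4F · 7F · 9F) ∷ (5F · 7F · 8F) ∷ []

t₆ : Table 10
t₆ =
  (1F · 2F · 3F) ∷ (0F · 4F · 5F) ∷ (0F · 4F · 6F) ∷ (0F · 5F · 7F) ∷ (1F · 2F · 8F) ∷
  (1F · 3F · 9F) ∷ (2F · 8F · 9F) ∷ (3F · 8F · 9F) ∷ (4F · 6F · 7F) ∷ (5F · 6F · 7F) ∷ []

t₇ : Table 10
t₇ =
  (1F · 2F · 3F) ∷ (0F · 4F · 5F) ∷ (0F · 6F · 7F) ∷ (0F · 8F · 9F) ∷ (1F · 6F · 8F) ∷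
  (1F · 7F · 9F) ∷ (2F · 4F · 9F) ∷ (2F · 5F · 8F) ∷ (3F · 4F · 7F) ∷ (3F · 5F · 6F) ∷ []

distinct? : ∀ {n} (t : Table n) → Dec (Distinct t)
distinct? t = all? λ i → all? λ k → all? λ l →
  (lookup (lookup t i) k ≟ lookup (lookup t i) l) →-dec (k ≟ l)

Obstruction : Table 10 → Set
Obstruction t = Distinct t × fewFaces t ≡ true

obstructions : List (Table 10)
obstructions = t₁ ∷ t₂ ∷ t₃ ∷ t₄ ∷ t₅ ∷ t₆ ∷ t₇ ∷ []

obstructions-valid : All Obstruction obstructions
obstructions-valid =
  (from-yes (distinct? t₁) , refl) ∷ (from-yes (distinct? t₂) , refl) ∷
  (from-yes (distinct? t₃) , refl) ∷ (from-yes (distinct? t₄) , refl) ∷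
  (from-yes (distinct? t₅) , refl) ∷ (from-yes (distinct? t₆) , refl) ∷
  (from-yes (distinct? t₇) , refl) ∷ []

colourings : Rows 10 → List (Vec (Fin 7) 10)
colourings R = map (colouring R) (cliques R 3 (farPairs R))

-- Type checking this `refl` runs the enumeration and tests every leaf.
all-solved : search 3 (solved colourings embeddings obstructions 3) ≡ true
all-solved = refl

colourable-10 : (G : Graph 10) → Planar G → Regular G 3 → IsDiameter G 3 → HarmoniouslyColorable G 7
colourable-10 G planar regular diameter =
  search-sound G regular connected (solved colourings embeddings obstructions 3)
    (solved-sound colourings embeddings obstructions 3 G near obstruct) all-solved
  where
  near : ∀ u v → ∃[ k ] Walk G u v k × k ≤ 3
  near u v with proj₁ diameter u v
  ... | k , (walk , _) , k≤3 = k , walk , k≤3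

  connected : ∀ u v → Reachable G u v
  connected u v = proj₁ (near u v) , proj₁ (proj₂ (near u v))

  obstruct : All (λ t → ¬ Presentation G (rows t)) obstructions
  obstruct = All.map (λ {t} (distinct , few) P →
    nonplanar G t P distinct few regular planar) obstructions-valid

proposition18 : (n : ℕ) (G : Graph n) →
    n ≡ 8 ⊎ n ≡ 10 →
    Planar G → Regular G 3 → IsDiameter G 3 →
    IsHarmoniousChromaticNumber G 7
proposition18 n G n≡ planar regular diameter =
  s≤s z≤n , colourable n≡ G planar regular diameter , minimal
  where
  colourable : ∀ {n} → n ≡ 8 ⊎ n ≡ 10 → (G : Graph n) → Planar G → Regular G 3 → IsDiameter G 3 →
    HarmoniouslyColorable G 7
  colourable (inj₁ refl) G _ _ (_ , _ , _ , far) = merge-far-pair G far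
  colourable (inj₂ refl) G planar regular diameter = colourable-10 G planar regular diameter

  7≤n : ∀ {n} → n ≡ 8 ⊎ n ≡ 10 → 7 ≤ n
  7≤n (inj₁ refl) = from-yes (7 ℕ.≤? 8)
  7≤n (inj₂ refl) = from-yes (7 ℕ.≤? 10)

  minimal : ∀ j → 1 ≤ j → HarmoniouslyColorable G j → 7 ≤ j
  minimal j _ colouring with j <? n
  ... | yes j<n = harmonious-bound G regular colouring j<n
  -- With n or more colours no repetition is forced, but then `j` is at least 8 or 10 anyway.
  ... | no j≮n  = ≤-trans (7≤n n≡) (≮⇒≥ j≮n)
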